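{- (ZFC) If $\kappa$ is a singular cardinal, then there is no minimal access ideal on $\kappa$. In particular, for the natural well-ordering $<$ of $\kappa$, $Seg(<)$ is not a minimal access ideal for $\kappa$; more precisely, for every preordering $\preccurlyeq$ of $\kappa$ there is a preordering $\preccurlyeq_1$ of $\kappa$ with $Seg(\preccurlyeq_1)\subsetneq Seg(\preccurlyeq)$.
   Context: An ideal on a set $X$ is a collection $\mathcal I$ of subsets of $X$ such that (i) $Y_1,Y_2\in\mathcal I\Rightarrow Y_1\cup Y_2\in\mathcal I$, (ii) $Y\in\mathcal I$, $Z\subseteq Y\Rightarrow Z\in\mathcal I$, (iii) $X\notin\mathcal I$. A preordering of $X$ is a reflexive, transitive, total binary relation $\preccurlyeq$ on $X$; throughout, all preorderings are assumed to have no last element. For $x\in X$ let ${\preccurlyeq_x}=\{y\in X:y\preccurlyeq x\}$. $Seg(\preccurlyeq)$ denotes the ideal of subsets $Y\subseteq X$ with $Y\subseteq{\preccurlyeq_x}$ for some $x\in X$. An ideal $\mathcal I$ on $X$ is an access ideal for $X$ if there is a preordering $\preccurlyeq$ of $X$ with $Seg(\preccurlyeq)\subseteq\mathcal I$. $\mathcal I$ is a minimal access ideal for $X$ if it is an access ideal for $X$ and for no ideal $\mathcal J\subsetneq\mathcal I$ is $\mathcal J$ an access ideal for $X$. -}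

module Defs where

open import Level using (Level; _⊔_; suc)
open import Data.Fin.Base using (Fin)
open import Data.Nat.Base using (ℕ)
open import Data.Product.Base using (∃; _×_; _,_)
open import Data.Refinement.Base using (Refinement-syntax)
open import Data.Sum.Base using (inj₁; inj₂; [_,_])
open import Data.Unit.Polymorphic.Base using (⊤; tt)
open import Function.Bundles using (_↔_)
open import Induction.WellFounded using (WellFounded)
open import Relation.Binary.Core using (Rel)
open import Relation.Binary.Construct.Closure.Reflexive using (ReflClosure)
open import Relation.Binary.PropositionalEquality.Core using (_≡_)
open import Relation.Binary.Structures using (IsStrictTotalOrder; IsTotalPreorder)
open import Relation.Nullary.Negation.Core using (¬_)
open import Relation.Unary using (Pred; _∈_; _∉_; _⊆_; _⊂_; _∪_)

-- A subset of X is a predicate `Pred X ℓ`, a collection of subsets a predicate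
-- on predicates.  Inclusion and strict inclusion are those of Relation.Unary;
-- `I ⊂ J` means that I ⊆ J and not J ⊆ I.

module _ {ℓ : Level} {X : Set ℓ} where

  record IsIdeal {i} (I : Pred (Pred X ℓ) i) : Set (suc ℓ ⊔ i) where
    field
      ∪-closed   : ∀ {Y₁ Y₂} → Y₁ ∈ I → Y₂ ∈ I → (Y₁ ∪ Y₂) ∈ I
      ⊆-closed   : ∀ {Y Z} → Y ∈ I → Z ⊆ Y → Z ∈ I
      whole-∉    : (λ _ → ⊤) ∉ I

  -- A last element is an x with y ≼ x for all y; it need not be unique, since
  -- ≼ is not assumed antisymmetric.
  record IsPreordering (_≼_ : Rel X ℓ) : Set ℓ where
    field
      isTotalPreorder : IsTotalPreorder _≡_ _≼_
      noLast          : ¬ (∃ λ x → ∀ y → y ≼ x)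

    open IsTotalPreorder isTotalPreorder public

  Seg : Rel X ℓ → Pred (Pred X ℓ) ℓ
  Seg _≼_ Y = ∃ λ x → Y ⊆ (_≼ x)

  seg-isIdeal : {_≼_ : Rel X ℓ} → IsPreordering _≼_ → IsIdeal (Seg _≼_)
  seg-isIdeal {_≼_} P = record
    { ∪-closed = union
    ; ⊆-closed = λ (x , Y⊆) Z⊆Y → x , λ z → Y⊆ (Z⊆Y z)
    ; whole-∉  = λ (x , all≼x) → noLast (x , λ y → all≼x {y} tt)
    }
    where
    open IsPreordering P
    union : ∀ {Y₁ Y₂} → Y₁ ∈ Seg _≼_ → Y₂ ∈ Seg _≼_ → (Y₁ ∪ Y₂) ∈ Seg _≼_
    union (x₁ , Y₁⊆) (x₂ , Y₂⊆) with total x₁ x₂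
    ... | inj₁ x₁≼x₂ = x₂ , [ (λ y → trans (Y₁⊆ y) x₁≼x₂) , (λ y → Y₂⊆ y) ]
    ... | inj₂ x₂≼x₁ = x₁ , [ (λ y → Y₁⊆ y) , (λ y → trans (Y₂⊆ y) x₂≼x₁) ]

  IsAccessIdeal : ∀ {i} → Pred (Pred X ℓ) i → Set (suc ℓ ⊔ i)
  IsAccessIdeal I =
    IsIdeal I × (∃ λ (_≼_ : Rel X ℓ) → IsPreordering _≼_ × Seg _≼_ ⊆ I)

  IsMinimalAccessIdeal : ∀ {i} → Pred (Pred X ℓ) i → Set (suc ℓ ⊔ suc i)
  IsMinimalAccessIdeal {i} I =
    IsAccessIdeal I ×
    ((J : Pred (Pred X ℓ) i) → IsIdeal J → J ⊂ I → ¬ IsAccessIdeal J)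

-- An ordinal κ is given, up to isomorphism, as a type X well-ordered by _<_;
-- the ordinals below κ are then the elements a of X, each identified with its
-- initial segment { b ∣ b < a }.

module _ {ℓ : Level} {X : Set ℓ} (_<_ : Rel X ℓ) where

  record IsWellOrder : Set ℓ where
    field
      isStrictTotalOrder : IsStrictTotalOrder _≡_ _<_
      wellFounded        : WellFounded _<_

    open IsStrictTotalOrder isStrictTotalOrder public

  -- The proof component is irrelevant, so that two elements of a segment are
  -- equal as soon as their values are; `b < a` need not be a proposition.
  Segment : X → Set ℓ
  Segment a = [ b ∈ X ∣ b < a ]

  record IsInfiniteCardinal : Set ℓ where
    field
      isWellOrder : IsWellOrder
      initial     : ∀ a → ¬ (X ↔ Segment a)
      infinite    : ∀ (n : ℕ) → ¬ (X ↔ Fin n)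

    open IsWellOrder isWellOrder public

  HasCofinalMapFrom : X → Set ℓ
  HasCofinalMapFrom a =
    ∃ λ (f : Segment a → X) → ∀ x → ∃ λ s → ReflClosure _<_ x (f s)

  -- a is the cofinality of κ (in particular, the cofinality is below κ).
  IsCofinality : X → Set ℓ
  IsCofinality a =
    HasCofinalMapFrom a × (∀ b → b < a → ¬ HasCofinalMapFrom b)

  record IsSingularCardinal : Set ℓ where
    field
      isInfiniteCardinal : IsInfiniteCardinal
      cofinality<κ       : ∃ λ a → IsCofinality a

    open IsInfiniteCardinal isInfiniteCardinal public

{-# OPTIONS --safe #-}

-- Call S ⊆ κ small if every map S → (κ, ≼) is ≼-bounded.  If some segment
-- {x ∣ x ≼ p} is not small, let h be unbounded on it and let m x bound both
-- x and h x: the preordering m x ≼ m y has a strictly smaller ideal of bounded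
-- sets.  Otherwise all ≼-segments are small.  Since κ is singular, not all
-- <-segments are small (an unbounded small family of small sets would cover κ);
-- take the least c such that {b ∣ b < c} is not small, with h : c → κ
-- unbounded.  Ordering κ by some chosen b < c with x ≼ h b, and then by <,
-- gives a well-order all of whose segments are small, hence do not map onto c.
-- Sending each x to the least value not yet used along it is a bijection of κ
-- with some d ≤ c, which is impossible as κ is a cardinal.

module Submission where

open import Defs
open import Axiom.DoubleNegationElimination using (em⇒dne)
open import Axiom.ExcludedMiddle using (ExcludedMiddle)
open import Data.Empty.Polymorphic using (⊥)
open import Data.Irrelevant using ([_])
open import Data.Product.Base using (∃; _×_; _,_; proj₁; proj₂)
open import Data.Product.Relation.Binary.Lex.Strict using (×-Lex; ×-wellFounded)
open import Data.Refinement.Base using (_,_; value)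
open import Data.Refinement.Properties using (value-injective)
open import Data.Sum.Base using (_⊎_; inj₁; inj₂)
open import Data.Unit.Polymorphic.Base using (⊤; tt)
open import Function.Base using (_∘_; _on_; id)
open import Function.Bundles using (_↔_; mk↔ₛ′)
open import Induction.WellFounded using (Acc; acc; WellFounded; WfRec; module All; module FixPoint)
open import Level using (Level; Lift; suc; lift; lower)
open import Relation.Binary.Core using (Rel)
open import Relation.Binary.Construct.Closure.Reflexive using (ReflClosure; refl; [_])
open import Relation.Binary.Definitions using (tri<; tri≈; tri>)
import Relation.Binary.Construct.On as On
open import Relation.Binary.PropositionalEquality.Core using (_≡_; _≢_; refl; sym; trans; cong; subst)
open import Relation.Nullary.Decidable.Core using (yes; no; map′; recompute)
open import Relation.Nullary.Negation.Core using (¬_; contradiction; contradiction-irr)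
open import Relation.Unary using (Pred; _∈_; _∉_; _⊆_; _⊂_; _≐_)

lower-em : ∀ {ℓ} → ExcludedMiddle (suc ℓ) → ExcludedMiddle ℓ
lower-em {ℓ} em {P} = map′ lower lift (em {Lift (suc ℓ) P})

-- The ideal I and the ideals Seg may live at unrelated levels i and ℓ.
module _ {ℓ i : Level} (em : ExcludedMiddle ℓ) where

  Resize : Set ℓ → Set i
  Resize P with em {P}
  ... | yes _ = ⊤
  ... | no  _ = ⊥

  resize : ∀ {P} → P → Resize P
  resize {P} p with em {P}
  ... | yes _ = tt
  ... | no ¬p = contradiction p ¬p

  unresize : ∀ {P} → Resize P → P
  unresize {P} r with em {P}
  ... | yes p = p
  unresize () | no _

module Classical {ℓ : Level} (em : ExcludedMiddle ℓ) where

  dne : ∀ {P : Set ℓ} → ¬ ¬ P → P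
  dne = em⇒dne em

  -- Least elements in a well-order.

  module _ {X : Set ℓ} {_<_ : Rel X ℓ} (wo : IsWellOrder _<_) where
    open IsWellOrder wo using (compare; wellFounded)

    Minimal : Pred X ℓ → Pred X ℓ
    Minimal P x = x ∈ P × (∀ {y} → y < x → y ∉ P)

    minimal : ∀ {P : Pred X ℓ} {x} → x ∈ P → ∃ (Minimal P)
    minimal {P} {x} = go (wellFounded x)
      where
      go : ∀ {x} → Acc _<_ x → x ∈ P → ∃ (Minimal P)
      go {x} (acc rs) x∈P with em {∃ λ y → y < x × y ∈ P}
      ... | yes (y , y<x , y∈P) = go (rs y<x) y∈P
      ... | no ∄y = x , x∈P , λ y<x y∈P → ∄y (_ , y<x , y∈P)

    minimal-unique : ∀ {P Q : Pred X ℓ} {x y} → P ≐ Q →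
                     x ∈ Minimal P → y ∈ Minimal Q → x ≡ y
    minimal-unique {x = x} {y} (P⊆Q , Q⊆P) (x∈P , x-min) (y∈Q , y-min)
      with compare x y
    ... | tri< x<y _ _ = contradiction (P⊆Q x∈P) (y-min x<y)
    ... | tri≈ _ x≡y _ = x≡y
    ... | tri> _ _ y<x = contradiction (Q⊆P y∈Q) (x-min y<x)

    -- The second argument is the junk value for empty P.
    least : Pred X ℓ → X → X
    least P d with em {∃ (Minimal P)}
    ... | yes (x , _) = x
    ... | no  _       = d

    least-minimal : ∀ {P x d} → x ∈ P → least P d ∈ Minimal P
    least-minimal {P} x∈P with em {∃ (Minimal P)}
    ... | yes (_ , min) = min
    ... | no ∄min       = contradiction (minimal x∈P) ∄min

    -- Pointwise equivalent sets suffice here, so that `step-cong` can supply the extensionality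
    -- that unfolding the recursion requires.
    least-cong : ∀ {P Q} d → P ≐ Q → least P d ≡ least Q d
    least-cong {P} {Q} d P≐Q@(P⊆Q , Q⊆P)
      with em {∃ (Minimal P)} | em {∃ (Minimal Q)}
    ... | yes (_ , p)       | yes (_ , q)       = minimal-unique P≐Q p q
    ... | yes (_ , x∈P , _) | no ∄q             = contradiction (minimal (P⊆Q x∈P)) ∄q
    ... | no ∄p             | yes (_ , x∈Q , _) = contradiction (minimal (Q⊆P x∈Q)) ∄p
    ... | no _              | no _              = refl

    -- Collapse of an order onto an initial segment.

    module Collapse
      {Y : Set ℓ} {_◁_ : Rel Y ℓ} (◁-wellFounded : WellFounded _◁_)
      (◁-connex : ∀ {y z} → y ≢ z → y ◁ z ⊎ z ◁ y)
      {c : X}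
      -- That is, no map sends the `◁`-predecessors of any `y` onto the segment below `c`.
      (fresh : ∀ (k : Y → X) y → ∃ λ b → b < c × (∀ z → z ◁ y → k z ≢ b))
      where

      Unused : ∀ y → WfRec _◁_ (λ _ → X) y → Pred X ℓ
      Unused y IH b = ∀ z (z◁y : z ◁ y) → IH z◁y ≢ b

      step : ∀ y → WfRec _◁_ (λ _ → X) y → X
      step y IH = least (Unused y IH) c

      step-cong : ∀ y {IH IH′ : WfRec _◁_ (λ _ → X) y} →
                  (∀ {z} z◁y → IH {z} z◁y ≡ IH′ z◁y) → step y IH ≡ step y IH′
      step-cong y eq = least-cong c
        ( (λ u z z◁y e → u z z◁y (trans (eq z◁y) e))
        , (λ u z z◁y e → u z z◁y (trans (sym (eq z◁y)) e)) )

      open FixPoint ◁-wellFounded (λ _ → X) step step-cong using (unfold-wfRec)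

      collapse : Y → X
      collapse = All.wfRec ◁-wellFounded ℓ (λ _ → X) step

      -- As `fresh` speaks of total maps, it applies to the finished `collapse`: no stage ran out of
      -- values, and the default `c` is never taken.
      collapse-minimal : ∀ y → collapse y ∈ Minimal (Unused y (λ {z} _ → collapse z))
      collapse-minimal y = subst (_∈ Minimal (Unused y (λ {z} _ → collapse z)))
        (sym unfold-wfRec) (least-minimal (proj₂ (proj₂ (fresh collapse y))))

      collapse<c : ∀ y → collapse y < c
      collapse<c y with fresh collapse y
      ... | b , b<c , b-unused with compare (collapse y) b
      ...   | tri< lt _ _ = IsWellOrder.trans wo lt b<c
      ...   | tri≈ _ e _  = subst (_< c) (sym e) b<c
      ...   | tri> _ _ gt = contradiction b-unused (proj₂ (collapse-minimal y) gt)

      collapse-injective : ∀ {y z} → collapse y ≡ collapse z → y ≡ z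
      collapse-injective {y} {z} e = dne λ y≢z → case y≢z (◁-connex y≢z)
        where
        case : y ≢ z → ¬ (y ◁ z ⊎ z ◁ y)
        case _ (inj₁ y◁z) = proj₁ (collapse-minimal z) y y◁z e
        case _ (inj₂ z◁y) = proj₁ (collapse-minimal y) z z◁y (sym e)

      Image : Pred X ℓ
      Image b = ∃ λ y → collapse y ≡ b

      image-downward : ∀ {b} y → b < collapse y → b ∈ Image
      image-downward y b<y = dne λ b∉ →
        proj₂ (collapse-minimal y) b<y (λ z _ e → b∉ (z , e))

      -- The image is downward closed and omits `c`, so it is exactly the segment below its least
      -- missing value `d`.
      ↔Segment : ∃ λ d → Y ↔ Segment _<_ d
      ↔Segment with minimal {P = _∉ Image} {x = c}
                      (λ (y , e) → IsWellOrder.irrefl wo e (collapse<c y))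
      ... | d , d∉ , d-min = d , mk↔ₛ′ to from
            (λ (b , [ b<d ]) → value-injective (proj₂ (preimage b<d)))
            (λ y → collapse-injective (proj₂ (preimage (collapse<d y))))
        where
        collapse<d : ∀ y → collapse y < d
        collapse<d y with compare (collapse y) d
        ... | tri< lt _ _ = lt
        ... | tri≈ _ e _  = contradiction (y , e) d∉
        ... | tri> _ _ gt = contradiction (image-downward y gt) d∉
        preimage : ∀ {b} → .(b < d) → b ∈ Image
        preimage b<d = dne (d-min (recompute em b<d))
        to : Y → Segment _<_ d
        to y = collapse y , [ collapse<d y ]
        from : Segment _<_ d → Y
        from (b , [ b<d ]) = proj₁ (preimage b<d)

  -- Small sets and refinements of a preordering.

  module _ {X : Set ℓ} {_≼_ : Rel X ℓ} (po : IsPreordering _≼_) where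
    private module ≼ = IsPreordering po

    Small : Pred (Pred X ℓ) ℓ
    Small S = ∀ (h : X → X) → ∃ λ u → ∀ {x} → x ∈ S → h x ≼ u

    upper-bound : ∀ x y → ∃ λ z → x ≼ z × y ≼ z
    upper-bound x y with ≼.total x y
    ... | inj₁ x≼y = y , x≼y , ≼.refl
    ... | inj₂ y≼x = x , ≼.refl , y≼x

    small-segments⊎refinement :
      (∀ p → (_≼ p) ∈ Small) ⊎
      (∃ λ (_≼₁_ : Rel X ℓ) → IsPreordering _≼₁_ × (Seg _≼₁_ ⊂ Seg _≼_))
    small-segments⊎refinement
      with em {∃ λ p → ∃ λ (h : X → X) → ¬ (∃ λ u → ∀ {x} → x ≼ p → h x ≼ u)}
    ... | no ∄ = inj₁ λ p h → dne λ unbounded → ∄ (p , h , unbounded)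
    ... | yes (p , h , unbounded) = inj₂ ((_≼_ on m) , po₁ , ⊆-Seg , ⊉-Seg)
      where
      m : X → X
      m x = proj₁ (upper-bound x (h x))
      x≼m : ∀ {x} → x ≼ m x
      x≼m {x} = proj₁ (proj₂ (upper-bound x (h x)))
      h≼m : ∀ {x} → h x ≼ m x
      h≼m {x} = proj₂ (proj₂ (upper-bound x (h x)))
      po₁ : IsPreordering (_≼_ on m)
      po₁ = record
        { isTotalPreorder = record
          { isPreorder = record
            { isEquivalence = ≼.isEquivalence
            ; reflexive     = ≼.reflexive ∘ cong m
            ; trans         = ≼.trans
            }
          ; total = λ x y → ≼.total (m x) (m y)
          }
        ; noLast = λ (x , last) → ≼.noLast (m x , λ y → ≼.trans x≼m (last y))
        }
      ⊆-Seg : Seg (_≼_ on m) ⊆ Seg _≼_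
      ⊆-Seg (x , Y⊆) = m x , λ y∈Y → ≼.trans x≼m (Y⊆ y∈Y)
      ⊉-Seg : ¬ (Seg _≼_ ⊆ Seg (_≼_ on m))
      ⊉-Seg ⊇ with ⊇ {_≼ p} (p , id)
      -- The segment below `p` separates the two ideals: if `x` bounded it in the new order, `m x`
      -- would bound `h` on it.
      ... | x , seg⊆ = unbounded (m x , λ y≼p → ≼.trans h≼m (seg⊆ y≼p))

    -- Preorderings of a singular cardinal.

    module _ {_<_ : Rel X ℓ} (singular : IsSingularCardinal _<_) where
      open IsSingularCardinal singular
        using (isWellOrder; initial; cofinality<κ; wellFounded; compare)

      Unbounded : Pred X ℓ
      Unbounded c = ∃ λ (h : X → X) → ¬ (∃ λ u → ∀ {b} → b < c → h b ≼ u)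

      small⊎unbounded : (∀ c → (_< c) ∈ Small) ⊎ ∃ Unbounded
      small⊎unbounded with em {∃ Unbounded}
      ... | yes ∃c = inj₂ ∃c
      ... | no  ∄c = inj₁ λ c h → dne λ unbounded → ∄c (c , h , unbounded)

      ∃-unbounded : ∃ Unbounded
      ∃-unbounded with small⊎unbounded | cofinality<κ
      ... | inj₂ ∃c    | _ = ∃c
      ... | inj₁ small | a , (f , cofinal) , _ =
        contradiction (v , λ x → below x (cofinal x)) ≼.noLast
        where
        -- `g b` bounds `f b` together with everything `<`-below it, so by cofinality of `f` a bound
        -- for `g` below `a` is a last element. Outside `a` its value is arbitrary.
        g : X → X
        g b with em {b < a}
        ... | no _    = b
        ... | yes b<a = proj₁ (upper-bound (f (b , [ b<a ]))
                                           (proj₁ (small (f (b , [ b<a ])) id)))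
        below-g : ∀ {x} s → ReflClosure _<_ x (f s) → x ≼ g (value s)
        below-g (b , [ b<a ]) x≤fs with em {b < a}
        ... | no b≮a = contradiction-irr b<a b≮a
        below-g (b , [ b<a ]) refl | yes b<a′ = proj₁ (proj₂ (upper-bound _ _))
        below-g (b , [ b<a ]) [ x<fs ] | yes b<a′ =
          ≼.trans (proj₂ (small (f (b , [ b<a ])) id) x<fs) (proj₂ (proj₂ (upper-bound _ _)))
        v : X
        v = proj₁ (small a g)
        below : ∀ x → (∃ λ s → ReflClosure _<_ x (f s)) → x ≼ v
        below x (s@(b , [ b<a ]) , x≤fs) =
          ≼.trans (below-g s x≤fs) (proj₂ (small a g) (recompute em b<a))

      ¬small-segments : ¬ (∀ p → (_≼ p) ∈ Small)
      ¬small-segments small with minimal isWellOrder {P = Unbounded} (proj₂ ∃-unbounded)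
      ... | c , (h , unbounded) , c-min = initial (proj₁ ↔Segment) (proj₂ ↔Segment)
        where
        Covers : X → Pred X ℓ
        Covers x b = b < c × x ≼ h b

        -- By totality, an `x` lying below no `h b` would bound `h` on the segment below `c`.
        cover : ∀ x → ∃ (Covers x)
        cover x = dne λ ∄b → unbounded (x , λ {b} b<c → case ∄b b<c (≼.total x (h b)))
          where
          case : ∀ {b} → ¬ ∃ (Covers x) → b < c → x ≼ h b ⊎ h b ≼ x → h b ≼ x
          case ∄b b<c (inj₁ x≼hb) = contradiction (_ , b<c , x≼hb) ∄b
          case ∄b b<c (inj₂ hb≼x) = hb≼x

        rank : X → X
        rank x = proj₁ (cover x)

        _◁_ : Rel X ℓ
        _◁_ = ×-Lex _≡_ _<_ _<_ on (λ x → rank x , x)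

        ◁-wellFounded : WellFounded _◁_
        ◁-wellFounded = On.wellFounded (λ x → rank x , x) (×-wellFounded wellFounded wellFounded)

        ◁-connex : ∀ {x y} → x ≢ y → x ◁ y ⊎ y ◁ x
        ◁-connex {x} {y} x≢y with compare (rank x) (rank y) | compare x y
        ... | tri< lt _ _ | _           = inj₁ (inj₁ lt)
        ... | tri> _ _ gt | _           = inj₂ (inj₁ gt)
        ... | tri≈ _ e _  | tri< lt _ _ = inj₁ (inj₂ (e , lt))
        ... | tri≈ _ _ _  | tri≈ _ x≡y _ = contradiction x≡y x≢y
        ... | tri≈ _ e _  | tri> _ _ gt = inj₂ (inj₂ (sym e , gt))

        -- Minimality of `c` bounds `h` on the ranks below `rank y`; predecessors of equal rank are
        -- bounded by `h (rank y)` itself.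
        ◁-bounded : ∀ y → ∃ λ u → ∀ {x} → x ◁ y → x ≼ u
        ◁-bounded y with dne (λ ub → c-min (proj₁ (proj₂ (cover y))) (h , ub))
        ... | v , h≼v with upper-bound v (h (rank y))
        ...   | u , v≼u , hy≼u = u , λ {x} x◁y →
                ≼.trans (proj₂ (proj₂ (cover x))) (bound x◁y)
          where
          bound : ∀ {x} → x ◁ y → h (rank x) ≼ u
          bound (inj₁ lt)      = ≼.trans (h≼v lt) v≼u
          bound (inj₂ (e , _)) = subst (λ r → h r ≼ u) (sym e) hy≼u

        -- The predecessors of `y` lie in a small `≼`-segment, so `h ∘ k` is bounded on them; if `k`
        -- took every value below `c` there, this bound would bound `h` below `c`.
        fresh : ∀ (k : X → X) y → ∃ λ b → b < c × (∀ z → z ◁ y → k z ≢ b)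
        fresh k y with ◁-bounded y
        ... | u , ◁⊆≼u with small u (h ∘ k)
        ...   | v , hk≼v = dne λ ∄b → unbounded (v , λ {b} b<c →
                dne λ hb⋠v → ∄b (b , b<c , λ z z◁y kz≡b →
                  hb⋠v (subst (λ b → h b ≼ v) kz≡b (hk≼v (◁⊆≼u z◁y)))))

        open Collapse isWellOrder ◁-wellFounded ◁-connex fresh using (↔Segment)

      refinement : ∃ λ (_≼₁_ : Rel X ℓ) → IsPreordering _≼₁_ × (Seg _≼₁_ ⊂ Seg _≼_)
      refinement with small-segments⊎refinement
      ... | inj₁ small = contradiction small ¬small-segments
      ... | inj₂ r     = r

  -- Refining the preordering `≼` that witnesses access gives `Seg _≼₁_ ⊂ Seg _≼_ ⊆ I`, so the
  -- smaller segment ideal is an access ideal strictly inside `I`.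
  ¬minimal : ∀ {i} {X : Set ℓ} {_<_ : Rel X ℓ} → IsSingularCardinal _<_ →
             (I : Pred (Pred X ℓ) i) → ¬ IsMinimalAccessIdeal I
  ¬minimal {i} {X} singular I ((_ , _≼_ , po , Seg⊆I) , I-minimal)
    with refinement po singular
  ... | _≼₁_ , po₁ , Seg₁⊆Seg , Seg⊈Seg₁ =
    I-minimal J J-ideal
      ( (λ Y∈J → Seg⊆I (Seg₁⊆Seg (unresize em Y∈J)))
      , (λ I⊆J → Seg⊈Seg₁ λ Y∈Seg → unresize em (I⊆J (Seg⊆I Y∈Seg))) )
      (J-ideal , _≼₁_ , po₁ , resize em)
    where
    open IsIdeal (seg-isIdeal po₁)
    J : Pred (Pred X ℓ) i
    J Y = Resize em (Seg _≼₁_ Y)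
    J-ideal : IsIdeal J
    J-ideal = record
      { ∪-closed = λ Y₁∈J Y₂∈J → resize em (∪-closed (unresize em Y₁∈J) (unresize em Y₂∈J))
      ; ⊆-closed = λ Y∈J Z⊆Y → resize em (⊆-closed (unresize em Y∈J) Z⊆Y)
      ; whole-∉  = λ X∈J → whole-∉ (unresize em X∈J)
      }

theorem2p11 : ∀ {ℓ i} → ExcludedMiddle (suc ℓ) →
    (κ : Set ℓ) (_<_ : Rel κ ℓ) → IsSingularCardinal _<_ →
    ((I : Pred (Pred κ ℓ) i) → ¬ IsMinimalAccessIdeal I) ×
    (¬ IsMinimalAccessIdeal (Seg (ReflClosure _<_))) ×
    ((_≼_ : Rel κ ℓ) → IsPreordering _≼_ →
    ∃ λ (_≼₁_ : Rel κ ℓ) → IsPreordering _≼₁_ × (Seg _≼₁_ ⊂ Seg _≼_))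
theorem2p11 em κ _<_ singular =
  ¬minimal singular , ¬minimal singular _ , λ _≼_ po → refinement po singular
  where open Classical (lower-em em)
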